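{- Let $n\ge 1$. If $\phi$ is an existential first order sentence over the vocabulary $\{P_1,\ldots,P_n\}$ of $n$ unary predicates expressing the property that all Boolean combinations of the $n$ unary predicates are non-empty, then the size of $\phi$ is at least $(n+1)2^n$.
   Context: First order logic has equality; models have nonempty universe. An existential formula is one built from atomic formulas and negations of atomic formulas using only $\vee$, $\wedge$ and $\exists x_j$. The size $\mathrm{w}$ of a formula is defined by $\mathrm{w}(\phi)=1$ for atomic $\phi$, $\mathrm{w}(\neg\phi)=\mathrm{w}(\phi)$, $\mathrm{w}(\phi\vee\psi)=\mathrm{w}(\phi\wedge\psi)=\mathrm{w}(\phi)+\mathrm{w}(\psi)$, $\mathrm{w}(\exists x_j\phi)=\mathrm{w}(\phi)+1$. "All Boolean combinations are non-empty" in a $\{P_1,\ldots,P_n\}$-model means: for every $S\subseteq\{1,\ldots,n\}$ there is an element $x$ such that for each $i$, $P_i(x)$ holds iff $i\in S$. A sentence $\phi$ expresses a property if for every $\{P_1,\ldots,P_n\}$-model, $\phi$ is true in the model iff the model has the property. -}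

module Defs where

open import Data.Fin using (Fin)
open import Data.Fin.Subset using (Subset; _∈_)
open import Data.Nat using (ℕ; suc; _+_)
open import Data.Product using (_×_; ∃)
open import Data.Sum using (_⊎_)
open import Data.Vec.Functional as Vector using (Vector)
open import Function.Bundles using (_⇔_)
open import Level using (0ℓ)
open import Relation.Binary.Definitions using (DecidableEquality)
open import Relation.Binary.PropositionalEquality using (_≡_)
open import Relation.Nullary using (¬_)
open import Relation.Unary using (Pred; Decidable)

infix  8 _≈′_
infix  7 ¬′_
infixr 6 _∧′_
infixr 5 _∨′_
infix  4 ∃′_

-- First-order formulas with equality over n unary predicate symbols, with
-- free variables among k.  Variables are well-scoped de Bruijn indices: ∃′
-- binds index zero of its body.
data Formula (n : ℕ) : ℕ → Set where
  P′   : ∀ {k} → Fin n → Fin k → Formula n k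
  _≈′_ : ∀ {k} → Fin k → Fin k → Formula n k
  ¬′_  : ∀ {k} → Formula n k → Formula n k
  _∨′_ : ∀ {k} → Formula n k → Formula n k → Formula n k
  _∧′_ : ∀ {k} → Formula n k → Formula n k → Formula n k
  ∃′_  : ∀ {k} → Formula n (suc k) → Formula n k

Sentence : ℕ → Set
Sentence n = Formula n 0

data Atomic {n k : ℕ} : Formula n k → Set where
  P′   : ∀ i x → Atomic (P′ i x)
  _≈′_ : ∀ x y → Atomic (x ≈′ y)

data Existential {n : ℕ} : ∀ {k} → Formula n k → Set where
  atom  : ∀ {k} {φ : Formula n k} → Atomic φ → Existential φ
  ¬atom : ∀ {k} {φ : Formula n k} → Atomic φ → Existential (¬′ φ)
  _∨′_  : ∀ {k} {φ ψ : Formula n k} →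
          Existential φ → Existential ψ → Existential (φ ∨′ ψ)
  _∧′_  : ∀ {k} {φ ψ : Formula n k} →
          Existential φ → Existential ψ → Existential (φ ∧′ ψ)
  ∃′_   : ∀ {k} {φ : Formula n (suc k)} → Existential φ → Existential (∃′ φ)

size : ∀ {n k} → Formula n k → ℕ
size (P′ _ _) = 1
size (_ ≈′ _) = 1
size (¬′ φ)   = size φ
size (φ ∨′ ψ) = size φ + size ψ
size (φ ∧′ ψ) = size φ + size ψ
size (∃′ φ)   = size φ + 1

-- Nonempty structures.  Equality and the predicates are decidable because
-- atomic formulas are two-valued in classical logic; assuming excluded middle
-- this is no restriction.
record Model (n : ℕ) : Set₁ where
  field
    Carrier : Set
    point   : Carrier
    _≟_     : DecidableEquality Carrier
    P       : Fin n → Pred Carrier 0ℓ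
    P?      : ∀ i → Decidable (P i)

module _ {n : ℕ} (M : Model n) where
  open Model M

  Sat : ∀ {k} → Vector Carrier k → Formula n k → Set
  Sat ρ (P′ i x) = P i (ρ x)
  Sat ρ (x ≈′ y) = ρ x ≡ ρ y
  Sat ρ (¬′ φ)   = ¬ Sat ρ φ
  Sat ρ (φ ∨′ ψ) = Sat ρ φ ⊎ Sat ρ ψ
  Sat ρ (φ ∧′ ψ) = Sat ρ φ × Sat ρ ψ
  Sat ρ (∃′ φ)   = ∃ λ a → Sat (a Vector.∷ ρ) φ

  AllCombinationsNonempty : Set
  AllCombinationsNonempty =
    (S : Subset n) → ∃ λ x → ∀ i → P i x ⇔ i ∈ S

infix 4 _⊨_
_⊨_ : ∀ {n} → Model n → Sentence n → Set
M ⊨ φ = Sat M Vector.[] φ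

Expresses : ∀ {n} → Sentence n → (Model n → Set) → Set₁
Expresses {n} φ Property = (M : Model n) → M ⊨ φ ⇔ Property M

{-# OPTIONS --safe #-}
-- Let 𝔅 be the model whose elements are the subsets of {1, …, n}, the element
-- S lying in exactly the Pᵢ with i ∈ S.  It satisfies φ; fix a proof of this.
-- If the proof never inspects whether S lies in Pᵢ, then flipping this single
-- truth value preserves it, although no element realises the combination S
-- any more.  So the proof inspects all n·2ⁿ such truth values, each at its own
-- literal of φ.  Every inspected element is moreover the witness of some
-- quantifier of φ, which adds a further 2ⁿ.
module Submission where

open import Data.Bool using (Bool; true; false; not)
import Data.Bool as Bool
open import Data.Fin as Fin using (Fin; zero; suc)
open import Data.Fin.Properties using (2↔Bool; *↔×; injective⇒≤)
open import Data.Fin.Subset using (Subset; _∈_; outside)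
open import Data.Fin.Subset.Properties using (⊆-antisym)
open import Data.List using (List; []; _∷_; _++_; length; [_])
open import Data.List.Membership.Propositional using () renaming (_∈_ to _∈ₗ_)
open import Data.List.Membership.Propositional.Properties
  using (∈-++⁺ˡ; ∈-++⁺ʳ; ∈-++⁻)
import Data.List.Membership.DecPropositional as DecMembership
import Data.List.Membership.Setoid.Properties as Membership
open import Data.List.Properties using (length-++)
open import Data.List.Relation.Unary.Any using (here; there; index)
open import Data.Nat using (ℕ; zero; suc; _+_; _*_; _^_; _≤_; _≥_; z≤n; s≤s)
open import Data.Nat.Properties
  using (+-comm; +-mono-≤; ≤-refl; ≤-reflexive; ≤-trans; m≤m+n; m≤n+m)
open import Data.Product using (_×_; _,_; ∃; uncurry)
open import Data.Product.Function.NonDependent.Propositional using (_×-↔_)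
import Data.Product.Properties as Product
open import Data.Sum as Sum using (_⊎_; inj₁; inj₂)
open import Data.Vec as Vec using (lookup; replicate)
import Data.Vec.Functional as Vector
open import Data.Vec.Properties using (≡-dec; []=⇒lookup; lookup⇒[]=)
open import Function using (_∘_)
open import Function.Bundles using (_↔_; mk↔ₛ′; _⇔_; mk⇔; Equivalence; Injection; Inverse)
open import Function.Construct.Identity using (↔-id)
open import Function.Construct.Composition using (_↔-∘_)
open import Function.Properties.Inverse using (↔⇒↣)
open import Relation.Binary.Definitions using (DecidableEquality)
open import Relation.Binary.PropositionalEquality using (_≡_; refl; sym; trans; subst; setoid)
open import Relation.Nullary using (¬_; Dec; yes; no; contradiction)
open import Relation.Nullary.Decidable using (decidable-stable)
open import Defs

open Equivalence using (to; from)

-- A list position determines the element found there, so assigning to each element a position where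
-- it occurs is injective.
exhaustive⇒≤length : ∀ {A : Set} {m} → Fin m ↔ A →
                     (xs : List A) → (∀ a → a ∈ₗ xs) → m ≤ length xs
exhaustive⇒≤length {A} enum xs all∈ = injective⇒≤ {f = position} λ {k} {l} eq →
  Injection.injective (↔⇒↣ enum)
    (Membership.index-injective (setoid A)
      (all∈ (Inverse.to enum k)) (all∈ (Inverse.to enum l)) eq)
  where
  position = λ k → index (all∈ (Inverse.to enum k))

Fin↔Subset : ∀ n → Fin (2 ^ n) ↔ Subset n
Fin↔Subset zero    = mk↔ₛ′ (λ _ → Vec.[]) (λ _ → zero)
                       (λ { Vec.[] → refl }) (λ { zero → refl })
Fin↔Subset (suc n) = ∷↔ ↔-∘ ((2↔Bool ×-↔ Fin↔Subset n) ↔-∘ *↔×)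
  where
  ∷↔ : (Bool × Subset n) ↔ Subset (suc n)
  ∷↔ = mk↔ₛ′ (uncurry Vec._∷_) Vec.uncons
         (λ { (_ Vec.∷ _) → refl }) (λ _ → refl)

¬not-⇔ : ∀ b → ¬ (not b ≡ true ⇔ b ≡ true)
¬not-⇔ false iff with () ← to iff refl
¬not-⇔ true  iff with () ← from iff refl

_≟ₛ_ : ∀ {n} → DecidableEquality (Subset n)
_≟ₛ_ = ≡-dec Bool._≟_

-- (suc i , S) records an inspection of Pᵢ at S, and (zero , S) a choice of S
-- as the witness of a quantifier.
Entry : ℕ → Set
Entry n = Fin (suc n) × Subset n

_≟ₑ_ : ∀ {n} → DecidableEquality (Entry n)
_≟ₑ_ = Product.≡-dec Fin._≟_ _≟ₛ_

_∈ₑ?_ : ∀ {n} (a : Entry n) xs → Dec (a ∈ₗ xs)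
_∈ₑ?_ = DecMembership._∈?_ _≟ₑ_

Valuation : ℕ → Set
Valuation n = Fin n → Subset n → Bool

-- All these models share one carrier, so equality atoms and the choice of witnesses do not depend
-- on the valuation.
⟦_⟧ : ∀ {n} → Valuation n → Model n
⟦_⟧ {n} v = record
  { Carrier = Subset n
  ; point   = replicate n outside
  ; _≟_     = _≟ₛ_
  ; P       = λ i S → v i S ≡ true
  ; P?      = λ i S → v i S Bool.≟ true
  }

-- Entries `(zero , S)` impose no condition: picking a witness does not consult the valuation.
AgreeOn : ∀ {n} → List (Entry n) → Valuation n → Valuation n → Set
AgreeOn xs v w = ∀ i S → (suc i , S) ∈ₗ xs → v i S ≡ w i S

module _ {n : ℕ} where

  atomTrace : ∀ {k} {φ : Formula n k} → Atomic φ → (Fin k → Subset n) →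
              List (Entry n)
  atomTrace (P′ i x)  ρ = [ suc i , ρ x ]
  atomTrace (x ≈′ y)  ρ = []

  trace : ∀ v {k} {φ : Formula n k} → Existential φ → ∀ ρ → Sat ⟦ v ⟧ ρ φ →
          List (Entry n)
  trace v (atom a)  ρ _        = atomTrace a ρ
  trace v (¬atom a) ρ _        = atomTrace a ρ
  trace v (d ∨′ e)  ρ (inj₁ p) = trace v d ρ p
  trace v (d ∨′ e)  ρ (inj₂ q) = trace v e ρ q
  trace v (d ∧′ e)  ρ (p , q)  = trace v d ρ p ++ trace v e ρ q
  trace v (∃′ e)    ρ (S , p)  = (zero , S) ∷ trace v e (S Vector.∷ ρ) p

  length-atomTrace : ∀ {k} {φ : Formula n k} (a : Atomic φ) ρ →
                     length (atomTrace a ρ) ≤ size φ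
  length-atomTrace (P′ i x) ρ = ≤-refl
  length-atomTrace (x ≈′ y) ρ = z≤n

  -- Each literal met along the proof yields at most one entry and each quantifier exactly one, and
  -- each adds one to `size`; a disjunct that is not proved yields none.
  length-trace : ∀ v {k} {φ : Formula n k} (e : Existential φ) ρ p →
                 length (trace v e ρ p) ≤ size φ
  length-trace v (atom a)  ρ _ = length-atomTrace a ρ
  length-trace v (¬atom a) ρ _ = length-atomTrace a ρ
  length-trace v (d ∨′ e)  ρ (inj₁ p) = ≤-trans (length-trace v d ρ p) (m≤m+n _ _)
  length-trace v (d ∨′ e)  ρ (inj₂ q) = ≤-trans (length-trace v e ρ q) (m≤n+m _ _)
  length-trace v (d ∧′ e)  ρ (p , q) =
    ≤-trans (≤-reflexive (length-++ (trace v d ρ p)))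
            (+-mono-≤ (length-trace v d ρ p) (length-trace v e ρ q))
  length-trace v (∃′ e)    ρ (S , p) =
    ≤-trans (s≤s (length-trace v e _ p)) (≤-reflexive (+-comm 1 _))

  atom-transfer : ∀ {v w k} {φ : Formula n k} (a : Atomic φ) ρ →
                  AgreeOn (atomTrace a ρ) v w → Sat ⟦ v ⟧ ρ φ → Sat ⟦ w ⟧ ρ φ
  atom-transfer (P′ i x) ρ v≈w p = trans (sym (v≈w i (ρ x) (here refl))) p
  atom-transfer (x ≈′ y) ρ v≈w p = p

  -- The same disjuncts and witnesses serve for `w`: only predicate literals depend on the
  -- valuation, and those met are recorded.
  transfer : ∀ {v w k} {φ : Formula n k} (e : Existential φ) ρ p →
             AgreeOn (trace v e ρ p) v w → Sat ⟦ w ⟧ ρ φ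
  transfer (atom a)  ρ p v≈w = atom-transfer a ρ v≈w p
  -- A negated atom is carried over contrapositively, so the agreement is used from `w` back to `v`.
  transfer (¬atom a) ρ p v≈w =
    p ∘ atom-transfer a ρ (λ i S ∈tr → sym (v≈w i S ∈tr))
  transfer (d ∨′ e)  ρ (inj₁ p) v≈w = inj₁ (transfer d ρ p v≈w)
  transfer (d ∨′ e)  ρ (inj₂ q) v≈w = inj₂ (transfer e ρ q v≈w)
  transfer {v} (d ∧′ e) ρ (p , q) v≈w =
    transfer d ρ p (λ i S → v≈w i S ∘ ∈-++⁺ˡ) ,
    transfer e ρ q (λ i S → v≈w i S ∘ ∈-++⁺ʳ (trace v d ρ p))
  transfer (∃′ e)    ρ (S , p) v≈w =
    S , transfer e _ p (λ i T → v≈w i T ∘ there)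

  atom-inspected : ∀ {k} {φ : Formula n k} (a : Atomic φ) ρ {i S} →
                   (suc i , S) ∈ₗ atomTrace a ρ → ∃ λ x → S ≡ ρ x
  atom-inspected (P′ i x) ρ (here refl) = x , refl

  -- An inspected variable gets its value either from a quantifier inside the formula, which records
  -- it as a witness, or from the assignment `ρ`.
  inspected⇒chosen : ∀ v {k} {φ : Formula n k} (e : Existential φ) ρ p {i S} →
                     (suc i , S) ∈ₗ trace v e ρ p →
                     (zero , S) ∈ₗ trace v e ρ p ⊎ ∃ λ x → S ≡ ρ x
  inspected⇒chosen v (atom a)  ρ _ ∈tr = inj₂ (atom-inspected a ρ ∈tr)
  inspected⇒chosen v (¬atom a) ρ _ ∈tr = inj₂ (atom-inspected a ρ ∈tr)
  inspected⇒chosen v (d ∨′ e)  ρ (inj₁ p) ∈tr = inspected⇒chosen v d ρ p ∈tr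
  inspected⇒chosen v (d ∨′ e)  ρ (inj₂ q) ∈tr = inspected⇒chosen v e ρ q ∈tr
  inspected⇒chosen v (d ∧′ e)  ρ (p , q)  ∈tr with ∈-++⁻ (trace v d ρ p) ∈tr
  ... | inj₁ ∈d = Sum.map₁ ∈-++⁺ˡ (inspected⇒chosen v d ρ p ∈d)
  ... | inj₂ ∈e = Sum.map₁ (∈-++⁺ʳ (trace v d ρ p)) (inspected⇒chosen v e ρ q ∈e)
  inspected⇒chosen v (∃′ e) ρ (S , p) (there ∈tr)
    with inspected⇒chosen v e (S Vector.∷ ρ) p ∈tr
  ... | inj₁ ∈e           = inj₁ (there ∈e)
  -- The inspected variable is the one bound here, so its value is the witness at the head of the
  -- trace.
  ... | inj₂ (zero , refl) = inj₁ (here refl)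
  ... | inj₂ (suc x , eq)  = inj₂ (x , eq)

  full : Valuation n
  full i S = lookup S i

  full-allCombinations : AllCombinationsNonempty ⟦ full ⟧
  full-allCombinations S = S , λ i → mk⇔ (lookup⇒[]= i S) []=⇒lookup

  flipAt : Fin n → Subset n → Valuation n → Valuation n
  flipAt j T v i S with (i Fin.≟ j) | S ≟ₛ T
  ... | yes _ | yes _ = not (v i S)
  ... | _     | _     = v i S

  flipAt-here : ∀ j T v → flipAt j T v j T ≡ not (v j T)
  flipAt-here j T v with j Fin.≟ j | T ≟ₛ T
  ... | yes _  | yes _  = refl
  ... | yes _  | no T≢T = contradiction refl T≢T
  ... | no j≢j | _      = contradiction refl j≢j

  flipAt-elsewhere : ∀ j T v i S → ¬ (i ≡ j × S ≡ T) → flipAt j T v i S ≡ v i S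
  flipAt-elsewhere j T v i S other with i Fin.≟ j | S ≟ₛ T
  ... | yes i≡j | yes S≡T = contradiction (i≡j , S≡T) other
  ... | yes _   | no _    = refl
  ... | no _    | _       = refl

  -- Elements other than `T` still realise only their own combination, while `T` itself now has the
  -- wrong truth value at `j`.
  ¬allCombinations-flipAt : ∀ j T → ¬ AllCombinationsNonempty ⟦ flipAt j T full ⟧
  ¬allCombinations-flipAt j T all with all T
  ... | S , S-realises-T = S≢T S≡T
    where
    S≢T : ¬ S ≡ T
    S≢T refl = ¬not-⇔ (lookup S j) (mk⇔
      (λ p → []=⇒lookup (to (S-realises-T j) (trans (flipAt-here j S full) p)))
      (λ p → trans (sym (flipAt-here j S full))
                   (from (S-realises-T j) (lookup⇒[]= j S p))))

    unflipped : ∀ i → flipAt j T full i S ≡ lookup S i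
    unflipped i = flipAt-elsewhere j T full i S (λ { (_ , S≡T) → S≢T S≡T })

    S≡T : S ≡ T
    S≡T = ⊆-antisym
      (λ {i} i∈S → to (S-realises-T i) (trans (unflipped i) ([]=⇒lookup i∈S)))
      (λ {i} i∈T → lookup⇒[]= i S
        (trans (sym (unflipped i)) (from (S-realises-T i) i∈T)))

  module _ {φ : Sentence n} (e : Existential φ)
           (φ-expresses : Expresses φ AllCombinationsNonempty) where

    full⊨φ : ⟦ full ⟧ ⊨ φ
    full⊨φ = from (φ-expresses ⟦ full ⟧) full-allCombinations

    φ-trace : List (Entry n)
    φ-trace = trace full e Vector.[] full⊨φ

    -- The flip changes `full` only at `(j , T)`, so without this entry `φ` would remain true in a
    -- model that lacks the combination `T`.
    all-inspected : ∀ j T → (suc j , T) ∈ₗ φ-trace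
    all-inspected j T = decidable-stable ((suc j , T) ∈ₑ? φ-trace) λ ∉tr →
      ¬allCombinations-flipAt j T (to (φ-expresses ⟦ flipAt j T full ⟧)
        (transfer e Vector.[] full⊨φ λ i S ∈tr →
          sym (flipAt-elsewhere j T full i S λ { (refl , refl) → ∉tr ∈tr })))

    -- Being chosen is derived from being inspected, which takes some predicate `j`; this is where n
    -- ≥ 1 enters.
    all-chosen : Fin n → ∀ T → (zero , T) ∈ₗ φ-trace
    all-chosen j T
      with inspected⇒chosen full e Vector.[] full⊨φ (all-inspected j T)
    -- A sentence has no free variables, so the value cannot come from the assignment.
    ... | inj₁ ∈tr = ∈tr

    trace-exhaustive : Fin n → ∀ a → a ∈ₗ φ-trace
    trace-exhaustive j (zero  , T) = all-chosen j T
    trace-exhaustive _ (suc i , T) = all-inspected i T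

corollary17 : ∀ (n : ℕ) → n ≥ 1 →
    (φ : Sentence n) → Existential φ → Expresses φ AllCombinationsNonempty →
    size φ ≥ (n + 1) * 2 ^ n
corollary17 n@(suc _) _ φ e φ-expresses =
  -- There are `suc n * 2 ^ n` entries, all of them in the trace; `+-comm` turns `1 + n` into
  -- `n + 1`.
  subst (λ m → m * 2 ^ n ≤ size φ) (+-comm 1 n) (≤-trans
    (exhaustive⇒≤length ((↔-id _ ×-↔ Fin↔Subset n) ↔-∘ *↔×)
      (φ-trace e φ-expresses) (trace-exhaustive e φ-expresses zero))
    (length-trace full e Vector.[] (full⊨φ e φ-expresses)))
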